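{- Let $\kappa$ be a cardinal and let $F_\kappa$ be the free group on $\kappa$ generators. Then for every uncountable ordinal $\lambda$ there is a partition $F_\kappa=A_0\cup A_1$ into two cells such that there is no injective sequence $\vec{x}=\langle x_\xi : \xi<\lambda\rangle$ of elements of $F_\kappa$ and no $i\in 2$ with $\mathrm{FP}(\vec{x})\subseteq A_i$; that is, $\mathrm{Hind}(F_\kappa,\lambda)$ fails.
   Context: For a semigroup $(S,*)$, an ordinal $\alpha$ and a sequence $\vec{x}=\langle x_\xi : \xi<\alpha\rangle$ in $S$, $\mathrm{FP}(\vec{x})$ is the set of all finite products $x_{\xi_0}*x_{\xi_1}*\cdots*x_{\xi_l}$ with $l<\omega$ and $\xi_0<\xi_1<\cdots<\xi_l<\alpha$. $\mathrm{Hind}(S,\alpha)$ is the statement: for every partition $S=A_0\cup A_1$ into two cells there exist an (injective) sequence $\vec{x}=\langle x_\xi:\xi<\alpha\rangle$ in $S$ and an $i\in 2$ with $\mathrm{FP}(\vec{x})\subseteq A_i$. -}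

module Defs where

open import Level using (Level; _⊔_; suc)
open import Algebra.Bundles using (Semigroup; Group)
open import Data.Fin.Base using (Fin)
open import Data.List.Base using (List; []; _∷_; _++_; [_])
open import Data.List.NonEmpty.Base using (List⁺; foldl₁; map; toList)
open import Data.List.Properties using (++-assoc; ++-identityʳ)
open import Data.List.Relation.Unary.Linked using (Linked)
open import Data.Nat.Base using (ℕ)
open import Data.Product.Base using (∃-syntax; _×_; _,_)
open import Data.Sign.Base using (Sign; opposite)
open import Data.Sign.Properties using (opposite-involutive)
open import Function.Bundles using (_↣_)
open import Function.Definitions using (Injective)
open import Induction.WellFounded using (WellFounded)
open import Relation.Binary.Construct.Closure.Equivalence using (EqClosure; gmap; return; isEquivalence)
open import Relation.Binary.Core using (Rel)
open import Relation.Binary.PropositionalEquality using (_≡_; refl; sym; trans; cong; subst; subst₂)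
open import Relation.Binary.Structures using (IsStrictTotalOrder; IsEquivalence)
open import Relation.Nullary.Negation.Core using (¬_)
open import Relation.Unary using (Pred; _∈_; _⊆_)

-- An ordinal is given by a well-ordered set of that order type; the elements
-- of the carrier play the role of the ordinals ξ < α.
record Ordinal (b c : Level) : Set (suc (b ⊔ c)) where
  field
    Carrier            : Set b
    _<_                : Rel Carrier c
    isStrictTotalOrder : IsStrictTotalOrder _≡_ _<_
    wellFounded        : WellFounded _<_

Uncountable : ∀ {b c} → Ordinal b c → Set b
Uncountable α = ¬ (Ordinal.Carrier α ↣ ℕ)

module _ {s ℓ} (S : Semigroup s ℓ) where
  open Semigroup S renaming (Carrier to ∣S∣) using (_≈_; _∙_)

  -- Cells are subsets of the setoid S, so they must respect _≈_.  They may be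
  -- empty (the one-element group has no partition into two nonempty cells).
  record Partition (p : Level) : Set (s ⊔ ℓ ⊔ suc p) where
    field
      cell     : Fin 2 → Pred ∣S∣ p
      respects : ∀ i {x y} → x ≈ y → x ∈ cell i → y ∈ cell i
      covers   : ∀ x → ∃[ i ] x ∈ cell i
      disjoint : ∀ {i j x} → x ∈ cell i → x ∈ cell j → i ≡ j

  module _ {b c} (α : Ordinal b c) where
    open Ordinal α renaming (Carrier to ∣α∣) using (_<_)

    FP : (∣α∣ → ∣S∣) → Pred ∣S∣ (b ⊔ c ⊔ ℓ)
    FP x y = ∃[ ξs ] Linked _<_ (toList ξs) × y ≈ foldl₁ _∙_ (map x ξs)

    HasMonochromaticFP : ∀ {p} → Partition p → Set (s ⊔ ℓ ⊔ b ⊔ c ⊔ p)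
    HasMonochromaticFP A =
      ∃[ x ] Injective _≡_ _≈_ x × ∃[ i ] FP x ⊆ Partition.cell A i

    Hind : (p : Level) → Set (s ⊔ ℓ ⊔ b ⊔ c ⊔ suc p)
    Hind p = (A : Partition p) → HasMonochromaticFP A

-- Words in the letters x and x⁻¹ for x ∈ X, modulo the equivalence relation
-- generated by deleting adjacent pairs of mutually inverse letters.
module _ {a} (X : Set a) where

  Letter : Set a
  Letter = Sign × X

  Word : Set a
  Word = List Letter

module _ {a} {X : Set a} where

  inverseLetter : Letter X → Letter X
  inverseLetter (s , x) = opposite s , x

  inverseWord : Word X → Word X
  inverseWord []      = []
  inverseWord (l ∷ w) = inverseWord w ++ [ inverseLetter l ]

  data _⇝_ : Rel (Word X) a where
    cancel : ∀ u l v → (u ++ l ∷ inverseLetter l ∷ v) ⇝ (u ++ v)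

  _≋_ : Rel (Word X) a
  _≋_ = EqClosure _⇝_

  private
    module ≋ = IsEquivalence (isEquivalence _⇝_)

    inverseLetter-involutive : ∀ l → inverseLetter (inverseLetter l) ≡ l
    inverseLetter-involutive (s , x) = cong (_, x) (opposite-involutive s)

    inverseWord-++ : ∀ u v → inverseWord (u ++ v) ≡ inverseWord v ++ inverseWord u
    inverseWord-++ []      v = sym (++-identityʳ (inverseWord v))
    inverseWord-++ (l ∷ u) v =
      trans (cong (_++ [ inverseLetter l ]) (inverseWord-++ u v))
            (++-assoc (inverseWord v) (inverseWord u) _)

    ++-congˡ : ∀ w {u v} → u ≋ v → (w ++ u) ≋ (w ++ v)
    ++-congˡ w = gmap (w ++_) λ { (cancel u l v) →
      subst₂ _⇝_ (++-assoc w u _) (++-assoc w u v) (cancel (w ++ u) l v) }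

    ++-congʳ : ∀ w {u v} → u ≋ v → (u ++ w) ≋ (v ++ w)
    ++-congʳ w = gmap (_++ w) λ { (cancel u l v) →
      subst₂ _⇝_ (sym (++-assoc u _ w)) (sym (++-assoc u v w)) (cancel u l (v ++ w)) }

    ++-cong : ∀ {u u′ v v′} → u ≋ u′ → v ≋ v′ → (u ++ v) ≋ (u′ ++ v′)
    ++-cong {u′ = u′} {v = v} p q = ≋.trans (++-congʳ v p) (++-congˡ u′ q)

    inverseWord-cong : ∀ {u v} → u ≋ v → inverseWord u ≋ inverseWord v
    inverseWord-cong = gmap inverseWord λ { (cancel u l v) →
      subst₂ _⇝_ (sym (lemma u l v)) (sym (inverseWord-++ u v))
        (cancel (inverseWord v) (inverseLetter (inverseLetter l)) (inverseWord u)) }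
      where
      lemma : ∀ u l v → inverseWord (u ++ l ∷ inverseLetter l ∷ v) ≡
              inverseWord v ++ inverseLetter (inverseLetter l) ∷
                inverseLetter (inverseLetter (inverseLetter l)) ∷ inverseWord u
      lemma u l v rewrite inverseLetter-involutive (inverseLetter l) =
        trans (inverseWord-++ u _)
          (trans (cong (_++ inverseWord u) (++-assoc (inverseWord v) _ _))
                 (++-assoc (inverseWord v) _ (inverseWord u)))

    inverseʳ : ∀ w → (w ++ inverseWord w) ≋ []
    inverseʳ []      = ≋.refl
    inverseʳ (l ∷ w) = ≋.trans
      (≋.reflexive (cong (l ∷_) (sym (++-assoc w (inverseWord w) _))))
      (≋.trans (++-congˡ [ l ] (++-congʳ [ inverseLetter l ] (inverseʳ w)))
               (return (cancel [] l [])))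

    inverseˡ : ∀ w → (inverseWord w ++ w) ≋ []
    inverseˡ []      = ≋.refl
    inverseˡ (l ∷ w) = ≋.trans
      (≋.reflexive (++-assoc (inverseWord w) _ (l ∷ w)))
      (≋.trans (++-congˡ (inverseWord w) cancel′) (inverseˡ w))
      where
      cancel′ : (inverseLetter l ∷ l ∷ w) ≋ w
      cancel′ = subst (λ k → (inverseLetter l ∷ k ∷ w) ≋ w)
        (inverseLetter-involutive l) (return (cancel [] (inverseLetter l) w))

  freeGroup : Group a a
  freeGroup = record
    { Carrier = Word X
    ; _≈_     = _≋_
    ; _∙_     = _++_
    ; ε       = []
    ; _⁻¹     = inverseWord
    ; isGroup = record
      { isMonoid = record
        { isSemigroup = record
          { isMagma = record
            { isEquivalence = isEquivalence _⇝_
            ; ∙-cong        = ++-cong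
            }
          ; assoc = λ u v w → ≋.reflexive (++-assoc u v w)
          }
        ; identity = (λ _ → ≋.refl) , (λ w → ≋.reflexive (++-identityʳ w))
        }
      ; inverse = inverseˡ , inverseʳ
      ; ⁻¹-cong = inverseWord-cong
      }
    }

FreeGroup : ∀ {a} → Set a → Group a a
FreeGroup X = freeGroup {X = X}

{-# OPTIONS --safe #-}
module Submission where

open import Defs
open import Level using (_⊔_; 0ℓ; Lift; lift; lower)
open import Algebra.Bundles using (Group)
open import Axiom.ExcludedMiddle using (ExcludedMiddle)
open import Data.Fin.Base using (Fin; zero; suc; opposite)
import Data.Fin.Properties as Fin
open import Data.List.Base as List using (List; []; _∷_; _++_; _∷ʳ_; [_]; length; foldl; foldr; concat; applyUpTo)
open import Data.List.Membership.Propositional using (_∈_; _∉_)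
open import Data.List.Membership.Propositional.Properties using (∈-map⁺)
open import Data.List.NonEmpty.Base as List⁺ using (List⁺; _∷_; foldl₁)
open import Data.List.Properties using (++-assoc; length-++; foldr-++; concat-++; ++-identityʳ; applyUpTo-∷ʳ; map-applyUpTo)
open import Data.List.Relation.Unary.All as All using (All; []; _∷_)
open import Data.List.Relation.Unary.All.Properties using (++⁻ˡ; ++⁻ʳ)
open import Data.List.Relation.Unary.Linked as Linked using (Linked; []; [-]; _∷_)
open import Data.List.Relation.Unary.Linked.Properties using (applyUpTo⁺₂)
open import Data.Nat.Base using (ℕ; zero; suc; _+_; _*_; _≤_; _<_; _<′_; ≤′-refl; ≤′-step; z≤n; s≤s)
open import Data.Nat.Properties using (suc-injective; <⇒<′; +-cancelˡ-≤; *-monoʳ-≤; ≤-refl; ≤-trans; ≤-reflexive; <-≤-trans; <-irrefl; <-cmp; ≰⇒>; n≤1+n; m≤m+n; m≤n+m; +-monoʳ-≤; +-monoˡ-≤; +-cancelˡ-≡; +-comm; +-assoc; *-mono-≤; m≤m*n; _≤?_; _<?_; ≮⇒≥; module ≤-Reasoning)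
open import Data.Product.Base using (Σ-syntax; ∃-syntax; _×_; _,_; proj₁; proj₂)
open import Data.Sign.Properties using (opposite-involutive)
open import Data.Sum.Base using (_⊎_; inj₁; inj₂)
open import Function.Base using (_∘_)
open import Function.Bundles using (mk↣)
open import Induction.WellFounded using (Acc; acc)
open import Relation.Binary.Construct.Closure.Equivalence using (gfold; return)
open import Relation.Binary.Definitions using (DecidableEquality; tri<; tri≈; tri>)
open import Relation.Binary.PropositionalEquality using (_≡_; _≢_; refl; sym; trans; cong; subst; isEquivalence; module ≡-Reasoning)
open import Relation.Binary.Structures using (IsStrictTotalOrder)
open import Relation.Nullary.Decidable.Core using (Dec; yes; no; map′)
open import Relation.Nullary.Negation.Core using (¬_; contradiction)
open import Relation.Unary using (Pred)

-- The colour of an element is the parity of ⌊√ℓ⌋, where ℓ is its reduced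
-- length.  Given uncountably many distinct elements, some length n occurs along
-- an increasing ω-sequence.  Thin it out so that the reduced words are
-- u aᵢ vᵢ with a common prefix u and letters aᵢ that eventually leave every
-- finite set.  After conjugation by u the factors aᵢ vᵢ u still begin with aᵢ,
-- and along a further subsequence aᵢ₊₁ does not cancel into the preceding factor,
-- so the lengths of the initial products tend to infinity.  They increase by at
-- most n at each step, hence meet every interval of length n beyond the start,
-- and for large j all of [j², j² + n] has the colour of the parity of j.
--
-- Excluded middle for arbitrary types decides Σ-types with a witness, and so
-- provides all the choice that is needed.

-- Integer square roots

record IsRoot (k j : ℕ) : Set where
  constructor isRoot
  field
    lower : j * j ≤ k
    upper : k < suc j * suc j

isRoot-interval : ∀ {j k} → j * j ≤ k → k ≤ j * j + j → IsRoot k j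
isRoot-interval {j} {k} lo hi = isRoot lo (s≤s (begin
  k               ≤⟨ hi ⟩
  j * j + j       ≡⟨ +-comm (j * j) j ⟩
  j + j * j       ≤⟨ +-monoʳ-≤ j (*-monoʳ-≤ j (n≤1+n j)) ⟩
  j + j * suc j   ∎))
  where open ≤-Reasoning

isRoot-unique : ∀ {k i j} → IsRoot k i → IsRoot k j → i ≡ j
isRoot-unique {i = i} {j} (isRoot i²≤k k<) (isRoot j²≤k k<′) with <-cmp i j
... | tri< i<j _ _ = contradiction (<-≤-trans k< (≤-trans (*-mono-≤ i<j i<j) j²≤k)) (<-irrefl refl)
... | tri≈ _ i≡j _ = i≡j
... | tri> _ _ j<i = contradiction (<-≤-trans k<′ (≤-trans (*-mono-≤ j<i j<i) i²≤k)) (<-irrefl refl)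

root : ∀ k → ∃[ j ] IsRoot k j
root zero = 0 , isRoot z≤n (s≤s z≤n)
root (suc k) with root k
... | j , isRoot j²≤k k< with suc k <? suc j * suc j
...   | yes k+1< = j , isRoot (≤-trans j²≤k (n≤1+n k)) k+1<
...   | no  k+1≮ = suc j , isRoot-interval (≮⇒≥ k+1≮) (≤-trans k< (m≤m+n _ (suc j)))

-- An injective code: the square root of the value is the sum `m + n`, and the excess over the
-- square is `m`.
pair : ℕ → ℕ → ℕ
pair m n = (m + n) * (m + n) + m

pair-root : ∀ m n → IsRoot (pair m n) (m + n)
pair-root m n = isRoot-interval (m≤m+n _ m) (+-monoʳ-≤ ((m + n) * (m + n)) (m≤m+n m n))

pair-injective : ∀ m n m′ n′ → pair m n ≡ pair m′ n′ → m ≡ m′ × n ≡ n′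
pair-injective m n m′ n′ eq = m≡m′ , n≡n′
  where
  sums : m + n ≡ m′ + n′
  sums = isRoot-unique (pair-root m n)
    (subst (λ k → IsRoot k (m′ + n′)) (sym eq) (pair-root m′ n′))
  m≡m′ : m ≡ m′
  m≡m′ = +-cancelˡ-≡ ((m + n) * (m + n)) m m′
    (trans eq (cong (λ s → s * s + m′) (sym sums)))
  n≡n′ : n ≡ n′
  n≡n′ = +-cancelˡ-≡ m n n′ (trans sums (cong (_+ n′) (sym m≡m′)))

-- A colouring of ℕ with arbitrarily long runs of both colours

parity : ℕ → Fin 2
parity zero    = zero
parity (suc n) = opposite (parity n)

opposite≢ : ∀ (i : Fin 2) → opposite i ≢ i
opposite≢ zero       ()
opposite≢ (suc zero) ()

colour : ℕ → Fin 2
colour k = parity (proj₁ (root k))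

colour-root : ∀ {k j} → IsRoot k j → colour k ≡ parity j
colour-root {k} r = cong parity (isRoot-unique (proj₂ (root k)) r)

largeRoot : ∀ i n → ∃[ j ] n < j × parity j ≢ i
largeRoot i n with parity (suc n) Fin.≟ i
... | no  p≢i  = suc n , ≤-refl , p≢i
... | yes refl = suc (suc n) , n≤1+n _ , opposite≢ (parity (suc n))

-- The whole interval from j² to j² + j has root j and hence one colour; any root j > n whose parity
-- is not `i` will do.
farRun : ∀ i n → ∃[ N ] n ≤ N × (∀ {k} → N ≤ k → k ≤ N + n → colour k ≢ i)
farRun i n with largeRoot i n
-- Matching on a successor supplies the nonzero instance that `m≤m*n` asks for.
... | j@(suc _) , n<j , p≢i = j * j , ≤-trans n≤j (m≤m*n j j) , λ lo hi eq →
    p≢i (trans (sym (colour-root (isRoot-interval lo (≤-trans hi (+-monoʳ-≤ (j * j) n≤j))))) eq)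
  where
  n≤j : n ≤ j
  n≤j = ≤-trans (n≤1+n n) n<j

-- A discrete intermediate value argument: descend from `M` as long as the predecessor still reaches
-- `N`. A step of at most `n` from below `N` cannot jump over the interval.
hitsInterval : ∀ (h : ℕ → ℕ) {n N} → h 0 ≤ N → (∀ m → h (suc m) ≤ h m + n) →
  ∀ M → N ≤ h M → ∃[ m ] N ≤ h m × h m ≤ N + n
hitsInterval h {n} {N} h0≤N step zero    N≤h = 0 , N≤h , ≤-trans h0≤N (m≤m+n N n)
hitsInterval h {n} {N} h0≤N step (suc M) N≤h with N ≤? h M
... | yes N≤hM = hitsInterval h h0≤N step M N≤hM
... | no  N≰hM = suc M , N≤h , ≤-trans (step M) (+-monoˡ-≤ n (≤-trans (n≤1+n _) (≰⇒> N≰hM)))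

-- Classical reasoning

lowerEM : ∀ {a} b → ExcludedMiddle (a ⊔ b) → ExcludedMiddle a
lowerEM b em {P} = map′ lower lift (em {Lift b P})

Frequently : ∀ {p} → Pred ℕ p → Set p
Frequently P = ∀ N → ∃[ i ] N ≤ i × P i

¬frequently⇒eventually¬ : ∀ {p} → ExcludedMiddle p → {P : Pred ℕ p} →
  ¬ Frequently P → ∃[ N ] (∀ i → N ≤ i → ¬ P i)
¬frequently⇒eventually¬ em {P} ¬freq with em {∃[ N ] (∀ i → N ≤ i → ¬ P i)}
... | yes ev = ev
... | no ¬ev = contradiction freq ¬freq
  where
  freq : Frequently P
  freq N with em {∃[ i ] N ≤ i × P i}
  ... | yes e = e
  ... | no ¬e = contradiction (N , λ i N≤i Pi → ¬e (i , N≤i , Pi)) ¬ev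

-- Increasing sequences and enumerations in a well-order

module _ {b c} (em : ExcludedMiddle (b ⊔ c)) (α : Ordinal b c) where
  open Ordinal α renaming (Carrier to ∣α∣; _<_ to _≺_)
  open IsStrictTotalOrder isStrictTotalOrder using (compare)

  module _ (S : Pred ∣α∣ (b ⊔ c)) where

    Least : ∣α∣ → Set (b ⊔ c)
    Least m = S m × (∀ ξ → S ξ → ¬ ξ ≺ m)

    least : ∀ ξ → Acc _≺_ ξ → S ξ → ∃[ m ] Least m
    least ξ (acc rs) Sξ with em {∃[ η ] S η × η ≺ ξ}
    ... | yes (η , Sη , η≺ξ) = least η (rs η≺ξ) Sη
    ... | no ¬below          = ξ , Sξ , λ η Sη η≺ξ → ¬below (η , Sη , η≺ξ)

  module _ (S : Pred ∣α∣ (b ⊔ c)) where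

    Chain : Set (b ⊔ c)
    Chain = Σ[ f ∈ (ℕ → ∣α∣) ] (∀ i → f i ≺ f (suc i)) × (∀ i → S (f i))

    private
      Above : ∣α∣ → Pred ∣α∣ (b ⊔ c)
      Above y ξ = S ξ × y ≺ ξ

      module Greedy (ξ₀ : ∣α∣) (ξ₀-least : Least S ξ₀) where

        -- The decision is an explicit argument so that `passed-or-below` can carry the equation of
        -- its case split into the value of `e` by `cong`. With nothing of `S` above `y` the
        -- sequence stays at `y`.
        step : ∀ {y} → S y → Dec (∃[ z ] Least (Above y) z) → ∃[ z ] S z
        step {y} Sy (yes (z , (Sz , _) , _)) = z , Sz
        step {y} Sy (no _)                   = y , Sy

        e : ℕ → ∃[ z ] S z
        e zero    = ξ₀ , proj₁ ξ₀-least
        e (suc j) = step (proj₂ (e j)) em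

        -- Each step goes to the least element of `S` above the current one, so no element is
        -- skipped.
        passed-or-below : ∀ {ξ} → S ξ → ∀ j →
          (∃[ i ] proj₁ (e i) ≡ ξ) ⊎ (proj₁ (e j) ≺ ξ)
        passed-or-below {ξ} Sξ zero with compare ξ₀ ξ
        ... | tri< lt _ _ = inj₂ lt
        ... | tri≈ _ eq _ = inj₁ (0 , eq)
        ... | tri> _ _ gt = contradiction gt (proj₂ ξ₀-least ξ Sξ)
        passed-or-below {ξ} Sξ (suc j) with passed-or-below Sξ j
        ... | inj₁ passed = inj₁ passed
        ... | inj₂ ej≺ξ with em {∃[ z ] Least (Above (proj₁ (e j))) z} in eq
        ...   | no _ = inj₂ ej≺ξ
        ...   | yes (z , _ , z-least) with compare z ξ
        ...     | tri< lt _ _ = inj₂ lt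
        ...     | tri> _ _ gt = contradiction gt (z-least ξ (Sξ , ej≺ξ))
        ...     | tri≈ _ refl _ = inj₁ (suc j , cong (proj₁ ∘ step (proj₂ (e j))) eq)

        -- The element `ξ` witnesses that there is always something above `e j`, so the sequence
        -- never stalls.
        below⇒increasing : ∀ {ξ} → S ξ → (∀ j → proj₁ (e j) ≺ ξ) →
          ∀ j → proj₁ (e j) ≺ proj₁ (e (suc j))
        below⇒increasing {ξ} Sξ below j with em {∃[ z ] Least (Above (proj₁ (e j))) z}
        ... | yes (z , (_ , lt) , _) = lt
        ... | no ¬z = contradiction
              (least (Above (proj₁ (e j))) ξ (wellFounded ξ) (Sξ , below j)) ¬z

    Countable : Set (b ⊔ c)
    Countable = Σ[ r ∈ (∀ ξ → S ξ → ℕ) ] (∀ {ξ η} Sξ Sη → r ξ Sξ ≡ r η Sη → ξ ≡ η)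

    -- An element of `S` that the greedy sequence never reaches would lie above all of it and make
    -- it a chain. So every element is reached, and the stage at which this happens is its rank.
    ¬chain⇒countable : ¬ Chain → Countable
    ¬chain⇒countable ¬chain with em {∃[ ξ ] S ξ}
    ... | no empty = (λ ξ Sξ → contradiction (ξ , Sξ) empty) ,
                     (λ {ξ} Sξ → contradiction (ξ , Sξ) empty)
    ... | yes (ξ , Sξ) with least S ξ (wellFounded ξ) Sξ
    ...   | ξ₀ , ξ₀-least = (λ ξ Sξ → proj₁ (enumerates ξ Sξ)) ,
              λ {ξ} {η} Sξ Sη eq → trans (sym (proj₂ (enumerates ξ Sξ)))
                (trans (cong (proj₁ ∘ e) eq) (proj₂ (enumerates η Sη)))
      where
      open Greedy ξ₀ ξ₀-least
      enumerates : ∀ ξ → S ξ → ∃[ i ] proj₁ (e i) ≡ ξ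
      enumerates ξ Sξ with em {Lift c (∃[ i ] proj₁ (e i) ≡ ξ)}
      ... | yes (lift p) = p
      ... | no ¬p = contradiction
              (proj₁ ∘ e , below⇒increasing Sξ below , proj₂ ∘ e) ¬chain
        where
        below : ∀ j → proj₁ (e j) ≺ ξ
        below j with passed-or-below Sξ j
        ... | inj₁ passed = contradiction (lift passed) ¬p
        ... | inj₂ lt     = lt

  Fibre : (∣α∣ → ℕ) → ℕ → Pred ∣α∣ (b ⊔ c)
  Fibre h n ξ = Lift (b ⊔ c) (h ξ ≡ n)

  -- If no fibre contained a chain, all fibres would be countable, and an index could be coded by
  -- its value under `h` together with its rank in the fibre.
  chain-in-fibre : Uncountable α → (h : ∣α∣ → ℕ) → ∃[ n ] Chain (Fibre h n)
  chain-in-fibre uncountable h with em {∃[ n ] Chain (Fibre h n)}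
  ... | yes chain = chain
  ... | no ¬chain = contradiction (mk↣ {to = code} code-injective) uncountable
    where
    countable : ∀ n → Countable (Fibre h n)
    countable n = ¬chain⇒countable (Fibre h n) (λ ch → ¬chain (n , ch))

    rank : ∀ n ξ → Fibre h n ξ → ℕ
    rank n = proj₁ (countable n)

    code : ∣α∣ → ℕ
    code ξ = pair (h ξ) (rank (h ξ) ξ (lift refl))

    -- Stated for variables `m` and `n` so that their equality can be matched with `refl`, which
    -- fails for `h ξ ≡ h η`.
    rank-injective : ∀ {ξ η m n} (p : Fibre h m ξ) (q : Fibre h n η) →
      m ≡ n → rank m ξ p ≡ rank n η q → ξ ≡ η
    rank-injective {m = m} p q refl = proj₂ (countable m) p q

    code-injective : ∀ {ξ η} → code ξ ≡ code η → ξ ≡ η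
    code-injective {ξ} {η} eq with pair-injective (h ξ) _ (h η) _ eq
    ... | hξ≡hη , ranks≡ = rank-injective (lift refl) (lift refl) hξ≡hη ranks≡

-- Branching of sequences of words

module _ {a} {A : Set a} (em : ExcludedMiddle a) (w : ℕ → List A)
         (w-injective : ∀ {i j} → w i ≡ w j → i ≡ j) where

  Extends : List A → ℕ → Pred ℕ a
  Extends u n i = ∃[ v ] w i ≡ u ++ v × length v ≡ n

  -- Finding letters outside every finite `z`, arbitrarily late, allows each choice to avoid the
  -- letters of all words chosen before.
  BranchesAt : List A → Set a
  BranchesAt u = ∀ z N → ∃[ i ] N ≤ i × ∃[ l ] ∃[ v ] w i ≡ u ++ l ∷ v × l ∉ z

  -- Induction on the number of letters after `u`. If one letter follows `u` frequently, it is added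
  -- to the prefix; otherwise any finite set of letters is eventually avoided and `u` branches. With
  -- no letter left, two indices would carry the same word.
  branching : ∀ n u → Frequently (Extends u n) → ∃[ u′ ] BranchesAt u′
  branching zero u freq with freq 0
  ... | i , _ , [] , wi≡u , _ with freq (suc i)
  ...   | j , i<j , [] , wj≡u , _ =
    contradiction i<j (<-irrefl (w-injective (trans wi≡u (sym wj≡u))))
  branching (suc n) u freq with em {∃[ l ] Frequently (Extends (u ∷ʳ l) n)}
  ... | yes (l , freq′) = branching n (u ∷ʳ l) freq′
  ... | no ¬freq = u , branches
    where
    avoided : ∀ z → ∃[ N ] (∀ i → N ≤ i → All (λ l → ¬ Extends (u ∷ʳ l) n i) z)
    avoided [] = 0 , λ _ _ → []
    avoided (l ∷ z) with avoided z | ¬frequently⇒eventually¬ em (λ f → ¬freq (l , f))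
    ... | N , avz | M , avl = N + M , λ i le →
      avl i (≤-trans (m≤n+m M N) le) ∷ avz i (≤-trans (m≤m+n N M) le)
    branches : BranchesAt u
    branches z N with avoided z
    ... | M , av with freq (N + M)
    ...   | i , le , l ∷ v , eq , len = i , ≤-trans (m≤m+n N M) le , l , v , eq ,
      λ l∈z → All.lookup (av i (≤-trans (m≤n+m M N) le)) l∈z
        (v , trans eq (sym (++-assoc u [ l ] v)) , suc-injective len)

-- Reduced words

module Reduction {a} {X : Set a} (_≟_ : DecidableEquality (Letter X)) where
  open Group (FreeGroup X) using (∙-cong; inverseˡ) renaming (refl to ≋-refl; sym to ≋-sym; trans to ≋-trans; reflexive to ≋-reflexive)

  inverseLetter-involutive : ∀ (l : Letter X) → inverseLetter (inverseLetter l) ≡ l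
  inverseLetter-involutive (s , x) = cong (_, x) (opposite-involutive s)

  length-inverseWord : ∀ (w : Word X) → length (inverseWord w) ≡ length w
  length-inverseWord []      = refl
  length-inverseWord (l ∷ w) = trans (length-++ (inverseWord w))
    (trans (+-comm _ 1) (cong suc (length-inverseWord w)))

  Reduced : Word X → Set a
  Reduced = Linked (λ l m → m ≢ inverseLetter l)

  reduced-++⁻ʳ : ∀ u {v} → Reduced (u ++ v) → Reduced v
  reduced-++⁻ʳ []      red = red
  reduced-++⁻ʳ (l ∷ u) red = reduced-++⁻ʳ u (Linked.tail red)

  -- Letters act on reduced words as in van der Waerden's proof of the normal form. Reducing a word
  -- is letting it act on `[]`, so invariance under `≋` comes down to `push-inverse`.
  push : Letter X → Word X → Word X
  push l []      = [ l ]
  push l (m ∷ w) with m ≟ inverseLetter l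
  ... | yes _ = w
  ... | no  _ = l ∷ m ∷ w

  act : Word X → Word X → Word X
  act u w = foldr push w u

  reduce : Word X → Word X
  reduce u = act u []

  norm : Word X → ℕ
  norm w = length (reduce w)

  push-cancel : ∀ l w → push l (inverseLetter l ∷ w) ≡ w
  push-cancel l w with inverseLetter l ≟ inverseLetter l
  ... | yes _ = refl
  ... | no ¬p = contradiction refl ¬p

  push-≢ : ∀ {l m} w → m ≢ inverseLetter l → push l (m ∷ w) ≡ l ∷ m ∷ w
  push-≢ {l} {m} w m≢ with m ≟ inverseLetter l
  ... | yes eq = contradiction eq m≢
  ... | no  _  = refl

  push-reduced : ∀ l {w} → Reduced w → Reduced (push l w)
  push-reduced l {[]}    _   = [-]
  push-reduced l {m ∷ w} red with m ≟ inverseLetter l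
  ... | yes _ = Linked.tail red
  ... | no m≢ = m≢ ∷ red

  reduce-reduced : ∀ w → Reduced (reduce w)
  reduce-reduced []      = []
  reduce-reduced (l ∷ w) = push-reduced l (reduce-reduced w)

  push-∷ : ∀ {l w} → Reduced (l ∷ w) → push l w ≡ l ∷ w
  push-∷ [-]                = refl
  push-∷ (_∷_ {xs = w} m≢ _) = push-≢ w m≢

  -- If the word does not begin with `l`, the inverse letter is put in front and removed again. If
  -- it does, `l` is removed and put back, and reducedness keeps it from cancelling the next letter.
  push-inverse : ∀ l {w} → Reduced w → push l (push (inverseLetter l) w) ≡ w
  push-inverse l {[]}    red = push-cancel l []
  push-inverse l {m ∷ w} red with m ≟ inverseLetter (inverseLetter l)
  ... | no  _ = push-cancel l (m ∷ w)
  ... | yes refl rewrite inverseLetter-involutive l = push-∷ red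

  reduce-cong : ∀ {v w} → v ≋ w → reduce v ≡ reduce w
  reduce-cong = gfold isEquivalence reduce λ { (cancel u l v) → begin
    reduce (u ++ l ∷ inverseLetter l ∷ v)               ≡⟨ foldr-++ push [] u _ ⟩
    act u (push l (push (inverseLetter l) (reduce v)))  ≡⟨ cong (act u) (push-inverse l (reduce-reduced v)) ⟩
    act u (reduce v)                                    ≡⟨ foldr-++ push [] u v ⟨
    reduce (u ++ v)                                     ∎ }
    where open ≡-Reasoning

  push-≋ : ∀ l w → push l w ≋ (l ∷ w)
  push-≋ l []      = ≋-refl
  push-≋ l (m ∷ w) with m ≟ inverseLetter l
  ... | yes refl = ≋-sym (return (cancel [] l w))
  ... | no  _    = ≋-refl

  reduce-≋ : ∀ w → reduce w ≋ w
  reduce-≋ []      = ≋-refl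
  reduce-≋ (l ∷ w) = ≋-trans (push-≋ l (reduce w)) (∙-cong {x = [ l ]} ≋-refl (reduce-≋ w))

  reduce-injective : ∀ {v w} → reduce v ≡ reduce w → v ≋ w
  reduce-injective {v} {w} eq =
    ≋-trans (≋-sym (reduce-≋ v)) (≋-trans (≋-reflexive eq) (reduce-≋ w))

  length-push : ∀ l w → length (push l w) ≤ suc (length w)
  length-push l []      = ≤-refl
  length-push l (m ∷ w) with m ≟ inverseLetter l
  ... | yes _ = ≤-trans (n≤1+n _) (n≤1+n _)
  ... | no  _ = ≤-refl

  norm≤length : ∀ w → norm w ≤ length w
  norm≤length []      = z≤n
  norm≤length (l ∷ w) = ≤-trans (length-push l (reduce w)) (s≤s (norm≤length w))

  norm-++ : ∀ v w → norm (v ++ w) ≤ norm v + norm w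
  norm-++ v w = begin
    norm (v ++ w)                ≡⟨ cong length (reduce-cong (∙-cong (reduce-≋ v) (reduce-≋ w))) ⟨
    norm (reduce v ++ reduce w)  ≤⟨ norm≤length (reduce v ++ reduce w) ⟩
    length (reduce v ++ reduce w) ≡⟨ length-++ (reduce v) ⟩
    norm v + norm w              ∎
    where open ≤-Reasoning

  norm-++-length : ∀ v w → norm (v ++ w) ≤ norm v + length w
  norm-++-length v w = ≤-trans (norm-++ v w) (+-monoʳ-≤ (norm v) (norm≤length w))

  -- The triangle inequality for v = u⁻¹(uv).
  norm-shift : ∀ u v → norm v ≤ length u + norm (u ++ v)
  norm-shift u v = begin
    norm v                                    ≡⟨ cong length (reduce-cong u⁻¹uv≋v) ⟨
    norm (inverseWord u ++ (u ++ v))          ≤⟨ norm-++ (inverseWord u) (u ++ v) ⟩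
    norm (inverseWord u) + norm (u ++ v)      ≤⟨ +-monoˡ-≤ _ (norm≤length (inverseWord u)) ⟩
    length (inverseWord u) + norm (u ++ v)    ≡⟨ cong (_+ norm (u ++ v)) (length-inverseWord u) ⟩
    length u + norm (u ++ v)                  ∎
    where
    open ≤-Reasoning
    u⁻¹uv≋v : (inverseWord u ++ (u ++ v)) ≋ v
    u⁻¹uv≋v = ≋-trans (≋-reflexive (sym (++-assoc (inverseWord u) u v))) (∙-cong (inverseˡ u) ≋-refl)

  -- Letters that survive in products

  Avoids : Letter X → Word X → Set a
  Avoids l = All (_≢ inverseLetter l)

  ∉⇒avoids : ∀ {l} z → l ∉ List.map inverseLetter z → Avoids l z
  ∉⇒avoids {l} z l∉ = All.tabulate λ { {m} m∈z refl →
    l∉ (subst (_∈ List.map inverseLetter z) (inverseLetter-involutive l) (∈-map⁺ inverseLetter m∈z)) }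

  -- No letter of `z` can cancel `l`, so all cancellation happens to the left of `l`, exactly as in
  -- reducing `z` alone.
  act-avoiding : ∀ z {l w} → Avoids l z → act z (l ∷ w) ≡ reduce z ++ l ∷ w
  act-avoiding []      _ = refl
  act-avoiding (m ∷ z) {l} {w} (m≢ ∷ avoids)
    rewrite act-avoiding z {l} {w} avoids with reduce z
  -- Here `z` has cancelled to nothing and `m` meets `l`; if `l` were the inverse of `m`, then `m`
  -- would be the inverse of `l`.
  ... | []    = push-≢ w λ l≡ → m≢ (trans (sym (inverseLetter-involutive m)) (cong inverseLetter (sym l≡)))
  ... | k ∷ t with k ≟ inverseLetter m
  ...   | yes _ = refl
  ...   | no  _ = refl

  push-All : ∀ {p} {P : Pred (Letter X) p} l {w} → P l → All P w → All P (push l w)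
  push-All l {[]}    Pl _         = Pl ∷ []
  push-All l {m ∷ w} Pl (Pm ∷ Pw) with m ≟ inverseLetter l
  ... | yes _ = Pw
  ... | no  _ = Pl ∷ Pm ∷ Pw

  reduce-All : ∀ {p} {P : Pred (Letter X) p} {w} → All P w → All P (reduce w)
  reduce-All []                  = []
  reduce-All {w = l ∷ _} (Pl ∷ Pw) = push-All l Pl (reduce-All Pw)

  -- Either v is cancelled completely, leaving a suffix of t, or its first
  -- letter survives.
  act-reduced : ∀ {p} {P : Pred (Letter X) p} v {t} → Reduced v → All P t →
    All P (act v t) ⊎ (∃[ l ] ∃[ v′ ] ∃[ t′ ] v ≡ l ∷ v′ × act v t ≡ l ∷ t′)
  act-reduced []      _   Pt = inj₁ Pt
  act-reduced (l ∷ v) {t} red Pt with act v t | act-reduced v (Linked.tail red) Pt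
  act-reduced (l ∷ _) red _ | .(m ∷ t′) | inj₂ (m , v′ , t′ , refl , refl) =
    inj₂ (l , m ∷ v′ , m ∷ t′ , refl , push-≢ t′ (Linked.head red))
  ... | []    | inj₁ _ = inj₂ (l , v , [] , refl , refl)
  ... | m ∷ s | inj₁ (_ ∷ Ps) with m ≟ inverseLetter l
  ...   | yes _ = inj₁ Ps
  ...   | no  _ = inj₂ (l , v , m ∷ s , refl , refl)

  -- What `l` meets is either the first letter of `v`, harmless since `l ∷ v` is reduced, or a
  -- letter left over from `u`, harmless since `u` avoids `l`.
  reduce-∷-++ : ∀ {l} v {u} → Reduced (l ∷ v) → Avoids l u →
    reduce (l ∷ v ++ u) ≡ l ∷ reduce (v ++ u)
  reduce-∷-++ {l} v {u} red avoids
    rewrite foldr-++ push [] v u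
    with act v (reduce u) | act-reduced v (Linked.tail red) (reduce-All avoids)
  ... | []    | _                = refl
  ... | m ∷ s | inj₁ (m≢ ∷ _)    = push-≢ s m≢
  reduce-∷-++ {l} _ red _ | .(m ∷ t′) | inj₂ (m , _ , t′ , refl , refl) =
    push-≢ t′ (Linked.head red)

  -- Each factor cannot cancel the first letter of the product to its right, so the reduced forms
  -- are simply concatenated and every factor contributes at least one letter.
  norm-concat : ∀ (Y : ℕ → Word X) (l : ℕ → Letter X) →
    (∀ j → ∃[ r ] reduce (Y j) ≡ l j ∷ r) → (∀ j → Avoids (l (suc j)) (Y j)) →
    ∀ m → ∃[ r ] reduce (concat (applyUpTo Y (suc m))) ≡ l 0 ∷ r × m ≤ length r
  norm-concat Y l starts avoids zero
    rewrite ++-identityʳ (Y 0) with starts 0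
  ... | r , eq = r , eq , z≤n
  norm-concat Y l starts avoids (suc m)
    with starts 0 | norm-concat (Y ∘ suc) (l ∘ suc) (starts ∘ suc) (avoids ∘ suc) m
  ... | r , eq | s , eq′ , m≤s = r ++ l 1 ∷ s , eq″ , len
    where
    open ≡-Reasoning
    C = concat (applyUpTo (Y ∘ suc) (suc m))
    eq″ : reduce (Y 0 ++ C) ≡ l 0 ∷ r ++ l 1 ∷ s
    eq″ = begin
      reduce (Y 0 ++ C)        ≡⟨ foldr-++ push [] (Y 0) C ⟩
      act (Y 0) (reduce C)     ≡⟨ cong (act (Y 0)) eq′ ⟩
      act (Y 0) (l 1 ∷ s)      ≡⟨ act-avoiding (Y 0) (avoids 0) ⟩
      reduce (Y 0) ++ l 1 ∷ s  ≡⟨ cong (_++ l 1 ∷ s) eq ⟩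
      l 0 ∷ r ++ l 1 ∷ s       ∎
    len : suc m ≤ length (r ++ l 1 ∷ s)
    len = ≤-trans (s≤s m≤s) (≤-trans (m≤n+m _ (length r)) (≤-reflexive (sym (length-++ r))))

  -- The word `u` is moved to the left past one factor at a time.
  concat-conjugate : ∀ u (W Y : ℕ → Word X) → (∀ j → (W j ++ u) ≋ (u ++ Y j)) →
    ∀ m → (concat (applyUpTo W m) ++ u) ≋ (u ++ concat (applyUpTo Y m))
  concat-conjugate u W Y conj zero    = ≋-reflexive (sym (++-identityʳ u))
  concat-conjugate u W Y conj (suc m) =
    ≋-trans (≋-reflexive (++-assoc (W 0) _ u))
    (≋-trans (∙-cong {x = W 0} ≋-refl (concat-conjugate u (W ∘ suc) (Y ∘ suc) (conj ∘ suc) m))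
    (≋-trans (≋-reflexive (sym (++-assoc (W 0) u _)))
    (≋-trans (∙-cong (conj 0) ≋-refl)
    (≋-reflexive (++-assoc u (Y 0) _)))))

  norm-product-step : ∀ (W : ℕ → Word X) m →
    norm (concat (applyUpTo W (suc m))) ≤ norm (concat (applyUpTo W m)) + norm (W m)
  norm-product-step W m = ≤-trans (≤-reflexive (cong norm eq)) (norm-++ (concat (applyUpTo W m)) (W m))
    where
    eq : concat (applyUpTo W (suc m)) ≡ concat (applyUpTo W m) ++ W m
    eq = trans (cong concat (sym (applyUpTo-∷ʳ W m)))
         (trans (sym (concat-++ (applyUpTo W m) [ W m ]))
                (cong (concat (applyUpTo W m) ++_) (++-identityʳ (W m))))

  -- A subsequence with unbounded products

  module _ (em : ExcludedMiddle a) (x : ℕ → Word X) (x-injective : ∀ {i j} → x i ≋ x j → i ≡ j) where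

    -- For a word u a v, `conjugate` is u⁻¹(u a v)u = a v u. The field `avoids` ensures that the
    -- final u cannot cancel the leading a.
    record Node (u : Word X) : Set a where
      constructor node
      field
        index  : ℕ
        letter : Letter X
        suffix : Word X
        split  : reduce (x index) ≡ u ++ letter ∷ suffix
        avoids : Avoids letter u

      conjugate : Word X
      conjugate = letter ∷ suffix ++ u

    open Node

    conjugate-≋ : ∀ {u} (p : Node u) → (x (index p) ++ u) ≋ (u ++ conjugate p)
    conjugate-≋ {u} p = ≋-trans
      (∙-cong (≋-trans (≋-sym (reduce-≋ _)) (≋-reflexive (split p))) ≋-refl)
      (≋-reflexive (++-assoc u _ u))

    conjugate-starts : ∀ {u} (p : Node u) → ∃[ r ] reduce (conjugate p) ≡ letter p ∷ r
    conjugate-starts {u} p = _ , reduce-∷-++ (suffix p)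
      (reduced-++⁻ʳ u (subst Reduced (split p) (reduce-reduced (x (index p))))) (avoids p)

    private
      w-injective : ∀ {i j} → reduce (x i) ≡ reduce (x j) → i ≡ j
      w-injective = x-injective ∘ reduce-injective

    module _ {u : Word X} (branches : BranchesAt em (reduce ∘ x) w-injective u) where

      nodeAvoiding : ∀ z N → Σ[ p ∈ Node u ] N ≤ index p × Avoids (letter p) z
      -- The inverses of letters of `z` are excluded for the conclusion, those of `u` for the field
      -- `avoids`.
      nodeAvoiding z N with branches (List.map inverseLetter (z ++ u)) N
      ... | i , N≤i , l , v , eq , l∉ with ∉⇒avoids (z ++ u) l∉
      ...   | avoids = node i l v eq (++⁻ʳ z avoids) , N≤i , ++⁻ˡ z avoids

      nextNode : (p : Node u) → Σ[ q ∈ Node u ] index p < index q × Avoids (letter q) (conjugate p)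
      nextNode p = nodeAvoiding (conjugate p) (suc (index p))

      nodes : ℕ → Node u
      nodes zero    = proj₁ (nodeAvoiding [] 0)
      nodes (suc j) = proj₁ (nextNode (nodes j))

      -- The product of m + 1 conjugates has reduced length at least m + 1, and conjugation by `u`
      -- changes the reduced length by at most twice the length of `u`.
      norm-nodes : ∀ m → m ≤ length u + (norm (concat (applyUpTo (x ∘ index ∘ nodes) (suc m))) + length u)
      norm-nodes m with norm-concat (conjugate ∘ nodes) (letter ∘ nodes) (conjugate-starts ∘ nodes)
                          (λ j → proj₂ (proj₂ (nextNode (nodes j)))) m
      ... | r , eq , m≤r = begin
        m                                  ≤⟨ m≤r ⟩
        length r                           ≤⟨ n≤1+n _ ⟩
        suc (length r)                     ≡⟨ cong length eq ⟨
        norm Y                             ≤⟨ norm-shift u Y ⟩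
        length u + norm (u ++ Y)           ≡⟨ cong ((length u +_) ∘ length) (reduce-cong
                                                (concat-conjugate u _ _ (conjugate-≋ ∘ nodes) (suc m))) ⟨
        length u + norm (W ++ u)           ≤⟨ +-monoʳ-≤ (length u) (norm-++-length W u) ⟩
        length u + (norm W + length u)     ∎
        where
        open ≤-Reasoning
        W = concat (applyUpTo (x ∘ index ∘ nodes) (suc m))
        Y = concat (applyUpTo (conjugate ∘ nodes) (suc m))

    unbounded-products : ∀ n → (∀ i → norm (x i) ≡ n) → Σ[ g ∈ (ℕ → ℕ) ] (∀ j → g j < g (suc j)) ×
      ∃[ K ] (∀ m → m ≤ K + norm (concat (applyUpTo (x ∘ g) (suc m))))
    unbounded-products n norm-x with branching em (reduce ∘ x) w-injective n []
      -- The search starts from the empty prefix, after which all `n` letters remain at every index.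
      (λ N → N , ≤-refl , reduce (x N) , refl , norm-x N)
    ... | u , branches = index ∘ nodes branches ,
      (λ j → proj₁ (proj₂ (nextNode branches (nodes branches j)))) ,
      length u + length u , λ m → ≤-trans (norm-nodes branches m) (≤-reflexive (shuffle (length u) _))
      where
      shuffle : ∀ k l → k + (l + k) ≡ k + k + l
      shuffle k l = trans (cong (k +_) (+-comm l k)) (sym (+-assoc k k l))

-- The partition by reduced length

foldl-++≡concat : ∀ {a} {A : Set a} (w : List A) ws → foldl _++_ w ws ≡ w ++ concat ws
foldl-++≡concat w []       = sym (++-identityʳ w)
foldl-++≡concat w (v ∷ ws) = trans (foldl-++≡concat (w ++ v) ws) (++-assoc w v (concat ws))

module _ {a b c} (em : ExcludedMiddle (a ⊔ b ⊔ c)) (X : Set a) (α : Ordinal b c) where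
  open Ordinal α renaming (Carrier to ∣α∣; _<_ to _≺_)
  open IsStrictTotalOrder isStrictTotalOrder using (irrefl) renaming (trans to ≺-trans)

  private
    increasing : (f : ℕ → ∣α∣) → (∀ i → f i ≺ f (suc i)) → ∀ {i j} → i <′ j → f i ≺ f j
    increasing f step ≤′-refl       = step _
    increasing f step (≤′-step i<j) = ≺-trans (increasing f step i<j) (step _)

    F = Group.semigroup (FreeGroup X)

    em-a : ExcludedMiddle a
    em-a = lowerEM (b ⊔ c) em

    em-α : ExcludedMiddle (b ⊔ c)
    em-α = lowerEM a em

  open Reduction {X = X} (λ _ _ → em-a)

  lengthPartition : Partition F 0ℓ
  lengthPartition = record
    { cell     = λ i w → colour (norm w) ≡ i
    ; respects = λ i v≋w eq → trans (cong (colour ∘ length) (sym (reduce-cong v≋w))) eq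
    ; covers   = λ w → colour (norm w) , refl
    ; disjoint = λ p q → trans (sym p) q
    }

  private
    -- The initial products along `s` lie in `FP`. Their reduced lengths start at `n`, grow by at
    -- most `n` per step and are unbounded, so one of them falls into a run that misses the colour
    -- `i`.
    bothColours : ∀ (x : ∣α∣ → Word X) (s : ℕ → ∣α∣) → (∀ j → s j ≺ s (suc j)) →
      ∀ n → (∀ j → norm (x (s j)) ≡ n) →
      ∀ K → (∀ m → m ≤ K + norm (concat (applyUpTo (x ∘ s) (suc m)))) →
      ∀ i → ¬ (∀ {w} → FP F α x w → colour (norm w) ≡ i)
    bothColours x s s-incr n norm-s K unbounded i FP⊆ = run lo hi
      (trans (cong (colour ∘ norm) (sym (product≡ m))) (FP⊆ (inFP m)))
      where
      product : ℕ → Word X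
      product m = concat (applyUpTo (x ∘ s) (suc m))

      N = proj₁ (farRun i n)
      n≤N = proj₁ (proj₂ (farRun i n))
      run = proj₂ (proj₂ (farRun i n))

      start : norm (product 0) ≤ N
      start = ≤-trans (≤-reflexive (trans (cong norm (++-identityʳ (x (s 0)))) (norm-s 0))) n≤N

      step : ∀ m → norm (product (suc m)) ≤ norm (product m) + n
      step m = subst (λ k → norm (product (suc m)) ≤ norm (product m) + k)
        (norm-s (suc m)) (norm-product-step (x ∘ s) (suc m))

      hit : ∃[ m ] N ≤ norm (product m) × norm (product m) ≤ N + n
      -- At the index `K + N`, `unbounded` bounds `K + N` by `K` plus the norm of the product, and
      -- `K` cancels.
      hit = hitsInterval (norm ∘ product) start step (K + N)
              (+-cancelˡ-≤ K _ _ (unbounded (K + N)))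
      m = proj₁ hit
      lo = proj₁ (proj₂ hit)
      hi = proj₂ (proj₂ hit)

      ξs : ℕ → List⁺ ∣α∣
      ξs m = s 0 ∷ applyUpTo (s ∘ suc) m

      product≡ : ∀ m → foldl₁ _++_ (List⁺.map x (ξs m)) ≡ product m
      product≡ m = trans (foldl-++≡concat (x (s 0)) (List.map x (applyUpTo (s ∘ suc) m)))
        (cong (λ ws → x (s 0) ++ concat ws) (map-applyUpTo (s ∘ suc) x m))

      inFP : ∀ m → FP F α x (foldl₁ _++_ (List⁺.map x (ξs m)))
      -- The list underlying `ξs m` computes to `applyUpTo s (suc m)`.
      inFP m = ξs m , applyUpTo⁺₂ s (suc m) s-incr , Group.refl (FreeGroup X)

  lengthPartition-noFP : Uncountable α → ¬ HasMonochromaticFP F α lengthPartition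
  lengthPartition-noFP uncountable (x , x-injective , i , FP⊆) =
    noChain (chain-in-fibre em-α α uncountable (norm ∘ x))
    where
    noChain : ¬ (∃[ n ] Chain em-α α (Fibre em-α α (norm ∘ x) n))
    noChain (n , f , f-incr , f-norm) =
      noSubsequence (unbounded-products em-a (x ∘ f) (f-injective ∘ x-injective) n (lower ∘ f-norm))
      where
      f-injective : ∀ {i j} → f i ≡ f j → i ≡ j
      f-injective {i} {j} eq with <-cmp i j
      ... | tri< i<j _ _ = contradiction (increasing f f-incr (<⇒<′ i<j)) (irrefl eq)
      ... | tri≈ _ i≡j _ = i≡j
      ... | tri> _ _ j<i = contradiction (increasing f f-incr (<⇒<′ j<i)) (irrefl (sym eq))

      noSubsequence : ¬ (Σ[ g ∈ (ℕ → ℕ) ] (∀ j → g j < g (suc j)) ×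
        ∃[ K ] (∀ m → m ≤ K + norm (concat (applyUpTo (x ∘ f ∘ g) (suc m)))))
      noSubsequence (g , g-incr , K , unbounded) =
        bothColours x (f ∘ g) (λ j → increasing f f-incr (<⇒<′ (g-incr j)))
          n (λ j → lower (f-norm (g j))) K unbounded i FP⊆

theorem4p1 : ∀ {a b c} → ExcludedMiddle (a ⊔ b ⊔ c) →
    (κ : Set a) (λ′ : Ordinal b c) → Uncountable λ′ →
    let F = Group.semigroup (FreeGroup κ) in
    (Σ[ A ∈ Partition F 0ℓ ] ¬ HasMonochromaticFP F λ′ A) × ¬ Hind F λ′ 0ℓ
theorem4p1 em κ λ′ uncountable =
  (lengthPartition em κ λ′ , noFP) , λ hind → noFP (hind (lengthPartition em κ λ′))
  where noFP = lengthPartition-noFP em κ λ′ uncountable
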